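{- For every integer $n\geq 1$, the following identities hold in $\mathbb{Z}[x]$: (1) $F_n(3x) = C_{n-1}(x)-\sum_{k=1}^{n-2}\bigl(3xC_{n-k-1}(x)-2C_{n-k-2}(x)\bigr)F_k(3x)$; (2) $F_n(3x)+3xF_{n-1}(3x) = B_{n}(x)-\sum_{k=1}^{n-2}\bigl(3xB_{n-k}(x)-2B_{n-k-1}(x)\bigr)F_k(3x)$; (3) $9x^2F_{2n}(3x) = C_{2n+1}(x)-C_{2n-1}(x)-(27x^2-4)\sum_{k=0}^{n-1}C_{2(n-k)-1}(x)F_{2k+1}(3x)$; (4) $6xF_{2n+1}(3x) = B_{2(n+1)}(x)-B_{2n}(x)-(27x^2-4)\sum_{k=0}^{n-1}B_{2(n-k)}(x)F_{2k+1}(3x)$; (5) $F_{2n}(3x)+F_{2n-2}(3x) = 3xB_{2n-1}(x)-(27x^2-4)\sum_{k=1}^{n-1}B_{2(n-k)-1}(x)F_{2k}(3x)$; (6) $9x^2F_{2n-1}(3x) = 3xC_{2n-1}(x)-(27x^2-4)\sum_{k=1}^{n-1}C_{2(n-k)-1}(x)F_{2k}(3x)$; (7) $6xF_{2n}(3x) = 3xB_{2n}(x)-(27x^2-4)\sum_{k=1}^{n-1}B_{2(n-k)}(x)F_{2k}(3x)$.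
   Context: The balancing polynomials $B_n(x)$ and Lucas-balancing polynomials $C_n(x)$ both satisfy the recurrence $w_n(x)=6xw_{n-1}(x)-w_{n-2}(x)$ for $n\geq 2$, with initial values $B_0(x)=0$, $B_1(x)=1$ and $C_0(x)=1$, $C_1(x)=3x$. The (Catalan) Fibonacci polynomials $F_n(x)$ are defined by $F_0(x)=0$, $F_1(x)=1$, $F_n(x)=xF_{n-1}(x)+F_{n-2}(x)$ for $n\geq 2$; $F_n(3x)$ denotes the polynomial obtained by substituting $3x$ for $x$. A sum whose upper limit is smaller than its lower limit is $0$. -}

module Defs where

open import Data.Integer as ℤ using (ℤ; +_; 0ℤ)
open import Data.List using (List; []; _∷_; map; foldr; upTo)
open import Data.Nat as ℕ using (ℕ; zero; suc)
open import Relation.Binary.PropositionalEquality using (_≡_)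

infix  4 _≈_
infixl 6 _+ₚ_ _-ₚ_
infixl 7 _*ₚ_
infixr 8 _^ₚ_ -ₚ_
infix  9 #_ _⟨_⟩

-- Coefficient lists, constant term first.  Trailing zeros are allowed, so
-- equality in ℤ[x] is the setoid equality _≈_ below, not _≡_.
ℤ[x] : Set
ℤ[x] = List ℤ

coeff : ℤ[x] → ℕ → ℤ
coeff []      _       = 0ℤ
coeff (a ∷ p) zero    = a
coeff (a ∷ p) (suc i) = coeff p i

_≈_ : ℤ[x] → ℤ[x] → Set
p ≈ q = ∀ i → coeff p i ≡ coeff q i

0ₚ : ℤ[x]
0ₚ = []

const : ℤ → ℤ[x]
const a = a ∷ []

#_ : ℕ → ℤ[x]
# n = const (+ n)

x : ℤ[x]
x = + 0 ∷ + 1 ∷ []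

_+ₚ_ : ℤ[x] → ℤ[x] → ℤ[x]
[]      +ₚ q       = q
(a ∷ p) +ₚ []      = a ∷ p
(a ∷ p) +ₚ (b ∷ q) = (a ℤ.+ b) ∷ (p +ₚ q)

-ₚ_ : ℤ[x] → ℤ[x]
-ₚ_ = map (ℤ.-_)

_-ₚ_ : ℤ[x] → ℤ[x] → ℤ[x]
p -ₚ q = p +ₚ (-ₚ q)

-- (a + x p) q = a q + x (p q)
_*ₚ_ : ℤ[x] → ℤ[x] → ℤ[x]
[]      *ₚ q = 0ₚ
(a ∷ p) *ₚ q = map (a ℤ.*_) q +ₚ (0ℤ ∷ (p *ₚ q))

_^ₚ_ : ℤ[x] → ℕ → ℤ[x]
p ^ₚ zero  = # 1
p ^ₚ suc n = p *ₚ p ^ₚ n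

-- Substitution of q for x in p, by Horner's rule.
_⟨_⟩ : ℤ[x] → ℤ[x] → ℤ[x]
[]      ⟨ q ⟩ = 0ₚ
(a ∷ p) ⟨ q ⟩ = const a +ₚ q *ₚ (p ⟨ q ⟩)

-- The sum of f k over m ≤ k ≤ n, both ends included; it is 0ₚ when n < m.
∑ : ℕ → ℕ → (ℕ → ℤ[x]) → ℤ[x]
∑ m n f = foldr _+ₚ_ 0ₚ (map (λ j → f (m ℕ.+ j)) (upTo (suc n ℕ.∸ m)))

infix 5 ∑
syntax ∑ m n (λ k → p) = ∑[ k ∈ m ⋯ n ] p

3x : ℤ[x]
3x = # 3 *ₚ x

-- Balancing polynomials.
B : ℕ → ℤ[x]
B zero          = 0ₚ
B (suc zero)    = # 1
B (suc (suc n)) = # 6 *ₚ x *ₚ B (suc n) -ₚ B n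

-- Lucas-balancing polynomials.
C : ℕ → ℤ[x]
C zero          = # 1
C (suc zero)    = # 3 *ₚ x
C (suc (suc n)) = # 6 *ₚ x *ₚ C (suc n) -ₚ C n

-- (Catalan) Fibonacci polynomials.
F : ℕ → ℤ[x]
F zero          = 0ₚ
F (suc zero)    = # 1
F (suc (suc n)) = x *ₚ F (suc n) +ₚ F n

{-# OPTIONS --safe #-}
module Submission where

-- If a satisfies a(k+2) = P a(k+1) + Q a(k) and G satisfies the same recurrence
-- with an inhomogeneous term d, then by induction on n, shifting a,
--   a(0) G(n+1) + (a(1) − P a(0)) G(n)
--     = Σ_{k<n} d(n−1−k) a(k) + a(n) G(1) + (a(n+1) − P a(n)) G(0).
-- Write t = 3x.  For (1) and (2), a(k) = Fₖ₊₁(t), P = t, Q = 1, and the balancing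
-- recurrence w(m+2) = 2t w(m+1) − w(m) has the defect d(m) = t w(m+1) − 2 w(m).
-- For (3)–(7), a(k) is F₂ₖ₊₁(t) or F₂ₖ₊₂(t), with P = t² + 2 and Q = −1; every
-- other term of a balancing sequence satisfies w(m+4) = (4t² − 2) w(m+2) − w(m),
-- so its defect is (3t² − 4) w(m+2), which is where 27x² − 4 comes from.

open import Algebra.Bundles using (CommutativeRing)
open import Algebra.Solver.Ring.AlmostCommutativeRing using (fromCommutativeRing; _-Raw-AlmostCommutative⟶_)
open import Algebra.Structures using (IsCommutativeRing)
open import Data.Integer using (+_; -[1+_]; 0ℤ; 1ℤ; +-*-rawRing)
open import Data.List using (foldr; map; upTo; []; _∷_)
open import Data.List.Properties using (map-applyUpTo; map-upTo; map-cong)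
open import Data.Maybe using (Maybe; just; nothing)
open import Data.Nat as ℕ using (ℕ; zero; suc; _∸_)
open import Data.Product using (_×_; _,_)
open import Function using (_∘_)
open import Relation.Binary.PropositionalEquality as ≡ using (_≡_)
open import Relation.Nullary using (yes; no)
import Algebra.Properties.CommutativeSemigroup as CommutativeSemigroup
import Algebra.Solver.Ring as RingSolver
import Data.Integer as ℤ
import Data.Integer.Properties as ℤ
import Data.Integer.Solver as ℤ
import Data.Nat.Properties as ℕ
import Relation.Binary.Reasoning.Setoid as SetoidReasoning

-- The identities hold in any commutative ring that receives a homomorphism from
-- ℤ.  Working there keeps the equality abstract, whereas _≈_ on coefficient
-- lists unfolds and blocks the inference of implicit arguments.
module Identities {c ℓ} (R : CommutativeRing c ℓ)
  (ℤ⟶R : +-*-rawRing -Raw-AlmostCommutative⟶ fromCommutativeRing R)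
  where

  -- Finite sums and convolution with a linear recurrence.

  open CommutativeRing R
  open _-Raw-AlmostCommutative⟶_ ℤ⟶R using (⟦_⟧)
  open SetoidReasoning setoid
  private
    _coeff≟_ : ∀ a b → Maybe (⟦ a ⟧ ≈ ⟦ b ⟧)
    a coeff≟ b with a ℤ.≟ b
    ... | yes a≡b = just (reflexive (≡.cong ⟦_⟧ a≡b))
    ... | no  _   = nothing

  open RingSolver +-*-rawRing (fromCommutativeRing R) ℤ⟶R _coeff≟_
    using (solve; con; _:=_; _:+_; _:*_; _:-_; :-_)

  -- In ℤ[x], `∑ m n f` unfolds to `sum (suc n ∸ m)` of the summand shifted by `m`, so the final
  -- statements match by computation.
  sum : ℕ → (ℕ → Carrier) → Carrier
  sum n f = foldr _+_ 0# (map f (upTo n))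

  sum-suc : ∀ n f → sum (suc n) f ≡ f 0 + sum n (f ∘ suc)
  sum-suc n f = ≡.cong (λ fs → f 0 + foldr _+_ 0# fs)
    (≡.trans (map-applyUpTo suc f n) (≡.sym (map-upTo (f ∘ suc) n)))

  sum-cong : ∀ n {f g} → (∀ k → f k ≡ g k) → sum n f ≡ sum n g
  sum-cong n f≗g = ≡.cong (foldr _+_ 0#) (map-cong f≗g (upTo n))

  -- By h-shift, h n k depends on n − k only.
  module Convolution (P Q D : Carrier) (G : ℕ → Carrier) (h : ℕ → ℕ → Carrier)
    (G-rec : ∀ n → G (2 ℕ.+ n) ≈ P * G (1 ℕ.+ n) + Q * G n + D * h (suc n) 0)
    (h-shift : ∀ n k → h (suc n) (suc k) ≡ h n k)
    where

    -- The sequence `a` is quantified here and not fixed by the module, because the induction passes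
    -- to `a ∘ suc` while `G` and `h` stay.
    convolution : ∀ n (a : ℕ → Carrier) → (∀ k → a (2 ℕ.+ k) ≈ P * a (1 ℕ.+ k) + Q * a k) →
      a 0 * G (1 ℕ.+ n) + (a 1 - P * a 0) * G n ≈
      D * sum n (λ k → h n k * a k) + (a n * G 1 + (a (1 ℕ.+ n) - P * a n) * G 0)
    convolution zero a _ = sym (trans (+-congʳ (zeroʳ D)) (+-identityˡ _))
    convolution (suc n) a a-rec = begin
      a 0 * G (2 ℕ.+ n) + (a 1 - P * a 0) * G (1 ℕ.+ n)
        ≈⟨ +-congʳ (*-congˡ (G-rec n)) ⟩
      a 0 * (P * G (1 ℕ.+ n) + Q * G n + D * h (suc n) 0) + (a 1 - P * a 0) * G (1 ℕ.+ n)
        -- The bracket keeps `P * a 1` with both signs, so that the recurrence can fold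
        -- `P * a 1 + Q * a 0` into `a 2`; this gives the left side for `a ∘ suc`.
        ≈⟨ solve 8 (λ p q d g₀ g₁ h₀ a₀ a₁ →
             a₀ :* (p :* g₁ :+ q :* g₀ :+ d :* h₀) :+ (a₁ :- p :* a₀) :* g₁ :=
             d :* (h₀ :* a₀) :+ (a₁ :* g₁ :+ (p :* a₁ :+ q :* a₀ :- p :* a₁) :* g₀))
             refl P Q D (G n) (G (1 ℕ.+ n)) (h (suc n) 0) (a 0) (a 1) ⟩
      D * (h (suc n) 0 * a 0) + (a 1 * G (1 ℕ.+ n) + (P * a 1 + Q * a 0 - P * a 1) * G n)
        ≈⟨ +-congˡ (+-congˡ (*-congʳ (+-congʳ (a-rec 0)))) ⟨
      D * (h (suc n) 0 * a 0) + (a 1 * G (1 ℕ.+ n) + (a 2 - P * a 1) * G n)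
        ≈⟨ +-congˡ (convolution n (a ∘ suc) (a-rec ∘ suc)) ⟩
      D * (h (suc n) 0 * a 0) + (D * sum n (λ k → h n k * a (suc k)) + E)
        ≈⟨ solve 4 (λ d u s e → d :* u :+ (d :* s :+ e) := d :* (u :+ s) :+ e) refl D _ _ E ⟩
      D * (h (suc n) 0 * a 0 + sum n (λ k → h n k * a (suc k))) + E
        ≡⟨ ≡.cong (λ s → D * (h (suc n) 0 * a 0 + s) + E)
             (sum-cong n (λ k → ≡.cong (_* a (suc k)) (h-shift n k))) ⟨
      D * (h (suc n) 0 * a 0 + sum n (λ k → h (suc n) (suc k) * a (suc k))) + E
        ≡⟨ ≡.cong (λ s → D * s + E) (sum-suc n (λ k → h (suc n) k * a k)) ⟨
      D * sum (suc n) (λ k → h (suc n) k * a k) + E ∎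
      where E = a (suc n) * G 1 + (a (2 ℕ.+ n) - P * a (suc n)) * G 0

    -- The common form of the seven identities: `u` simplifies the boundary terms at `n`, the
    -- Fibonacci side, and `v` those at 0, the balancing side.
    convolution-difference : ∀ n (a : ℕ → Carrier) → (∀ k → a (2 ℕ.+ k) ≈ P * a (1 ℕ.+ k) + Q * a k) → ∀ {u v} →
      a n * G 1 + (a (1 ℕ.+ n) - P * a n) * G 0 ≈ u →
      a 0 * G (1 ℕ.+ n) + (a 1 - P * a 0) * G n ≈ v →
      u ≈ v - D * sum n (λ k → h n k * a k)
    convolution-difference n a a-rec {u} {v} eᵤ eᵥ = begin
      u         ≈⟨ solve 2 (λ s w → w := s :+ w :- s) refl S u ⟩
      S + u - S ≈⟨ +-congʳ (+-congˡ eᵤ) ⟨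
      S + _ - S ≈⟨ +-congʳ (convolution n a a-rec) ⟨
      _ - S     ≈⟨ +-congʳ eᵥ ⟩
      v - S     ∎
      where S = D * sum n (λ k → h n k * a k)

  -- One-step and two-step recurrences.

  module FibonacciBalancing (x : Carrier) (F B C : ℕ → Carrier)
    (F₀ : F 0 ≈ ⟦ + 0 ⟧) (F₁ : F 1 ≈ ⟦ + 1 ⟧)
    (F-rec : ∀ n → F (2 ℕ.+ n) ≈ ⟦ + 3 ⟧ * x * F (1 ℕ.+ n) + F n)
    (B₀ : B 0 ≈ ⟦ + 0 ⟧) (B₁ : B 1 ≈ ⟦ + 1 ⟧)
    (B-rec : ∀ n → B (2 ℕ.+ n) ≈ ⟦ + 6 ⟧ * x * B (1 ℕ.+ n) - B n)
    (C₀ : C 0 ≈ ⟦ + 1 ⟧) (C₁ : C 1 ≈ ⟦ + 3 ⟧ * x)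
    (C-rec : ∀ n → C (2 ℕ.+ n) ≈ ⟦ + 6 ⟧ * x * C (1 ℕ.+ n) - C n)
    where

    -- `F n` stands for the Fibonacci polynomial at `3x`, hence the factor `t` in its recurrence.
    -- `x²` is spelled the way `x ^ₚ 2` unfolds, so that `D` agrees with the factor in the theorem.
    t x² P Q D : Carrier
    t  = ⟦ + 3 ⟧ * x
    x² = x * (x * ⟦ + 1 ⟧)
    P  = t * t + ⟦ + 2 ⟧
    Q  = ⟦ -[1+ 0 ] ⟧
    D  = ⟦ + 27 ⟧ * x² - ⟦ + 4 ⟧

    F₂ : F 2 ≈ t
    F₂ = begin
      F 2                     ≈⟨ F-rec 0 ⟩
      t * F 1 + F 0           ≈⟨ +-cong (*-congˡ F₁) F₀ ⟩
      t * ⟦ + 1 ⟧ + ⟦ + 0 ⟧   ≈⟨ solve 1 (λ t → t :* con (+ 1) :+ con (+ 0) := t) refl t ⟩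
      t                       ∎

    F-step₃ : ∀ m → F (3 ℕ.+ m) ≈ (t * t + ⟦ + 1 ⟧) * F (1 ℕ.+ m) + t * F m
    F-step₃ m = begin
      F (3 ℕ.+ m)                                ≈⟨ F-rec (1 ℕ.+ m) ⟩
      t * F (2 ℕ.+ m) + F (1 ℕ.+ m)              ≈⟨ +-congʳ (*-congˡ (F-rec m)) ⟩
      t * (t * F (1 ℕ.+ m) + F m) + F (1 ℕ.+ m)
        ≈⟨ solve 3 (λ t y z → t :* (t :* z :+ y) :+ z := (t :* t :+ con (+ 1)) :* z :+ t :* y)
             refl t (F m) (F (1 ℕ.+ m)) ⟩
      (t * t + ⟦ + 1 ⟧) * F (1 ℕ.+ m) + t * F m  ∎

    -- Since `t * F (1 + m)` is `F (2 + m) - F m`, the term of the other parity drops out of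
    -- `F-step₃`.
    F-step₄ : ∀ m → F (4 ℕ.+ m) ≈ P * F (2 ℕ.+ m) + Q * F m
    F-step₄ m = begin
      F (4 ℕ.+ m)                                                    ≈⟨ F-step₃ (1 ℕ.+ m) ⟩
      (t * t + ⟦ + 1 ⟧) * F (2 ℕ.+ m) + t * F (1 ℕ.+ m)
        ≈⟨ solve 4 (λ t w y z → (t :* t :+ con (+ 1)) :* w :+ t :* z :=
             (t :* t :+ con (+ 1)) :* w :+ (t :* z :+ y) :+ con -[1+ 0 ] :* y)
             refl t (F (2 ℕ.+ m)) (F m) (F (1 ℕ.+ m)) ⟩
      (t * t + ⟦ + 1 ⟧) * F (2 ℕ.+ m) + (t * F (1 ℕ.+ m) + F m) + Q * F m
        ≈⟨ +-congʳ (+-congˡ (F-rec m)) ⟨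
      (t * t + ⟦ + 1 ⟧) * F (2 ℕ.+ m) + F (2 ℕ.+ m) + Q * F m
        ≈⟨ solve 3 (λ t w y → (t :* t :+ con (+ 1)) :* w :+ w :+ con -[1+ 0 ] :* y :=
             (t :* t :+ con (+ 2)) :* w :+ con -[1+ 0 ] :* y)
             refl t (F (2 ℕ.+ m)) (F m) ⟩
      P * F (2 ℕ.+ m) + Q * F m ∎

    -- Eliminating the terms of the other parity leaves the factor r² - 2 on `u (2 + m)`, with r =
    -- 6x. Then 36x² - 2 splits as (9x² + 2) + (27x² - 4), that is `P + D`.
    balancing-step₄ : ∀ (u : ℕ → Carrier) → (∀ n → u (2 ℕ.+ n) ≈ ⟦ + 6 ⟧ * x * u (1 ℕ.+ n) - u n) →
      ∀ m → u (4 ℕ.+ m) ≈ P * u (2 ℕ.+ m) + Q * u m + D * u (2 ℕ.+ m)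
    balancing-step₄ u u-rec m = begin
      u (4 ℕ.+ m)                                ≈⟨ u-rec (2 ℕ.+ m) ⟩
      r * u (3 ℕ.+ m) - u (2 ℕ.+ m)              ≈⟨ +-congʳ (*-congˡ (u-rec (1 ℕ.+ m))) ⟩
      r * (r * u (2 ℕ.+ m) - u (1 ℕ.+ m)) - u (2 ℕ.+ m)
        ≈⟨ solve 4 (λ r w y z → r :* (r :* w :- z) :- w :=
             r :* r :* w :- w :- (r :* z :- y) :- y)
             refl r (u (2 ℕ.+ m)) (u m) (u (1 ℕ.+ m)) ⟩
      r * r * u (2 ℕ.+ m) - u (2 ℕ.+ m) - (r * u (1 ℕ.+ m) - u m) - u m
        ≈⟨ +-congʳ (+-congˡ (-‿cong (u-rec m))) ⟨
      r * r * u (2 ℕ.+ m) - u (2 ℕ.+ m) - u (2 ℕ.+ m) - u m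
        ≈⟨ solve 3 (λ x w y → con (+ 6) :* x :* (con (+ 6) :* x) :* w :- w :- w :- y :=
             (con (+ 3) :* x :* (con (+ 3) :* x) :+ con (+ 2)) :* w :+ con -[1+ 0 ] :* y
             :+ (con (+ 27) :* (x :* (x :* con (+ 1))) :- con (+ 4)) :* w)
             refl x (u (2 ℕ.+ m)) (u m) ⟩
      P * u (2 ℕ.+ m) + Q * u m + D * u (2 ℕ.+ m) ∎
      where r = ⟦ + 6 ⟧ * x

    -- `2 * suc k` does not compute to `2 + 2 * k`, so each index map carries the equation `i-suc`;
    -- rewriting by it makes the two-step recurrences applicable.
    module EveryOther (i : ℕ → ℕ) (i-suc : ∀ k → i (suc k) ≡ 2 ℕ.+ i k) where

      F-rec₂ : ∀ k → F (i (2 ℕ.+ k)) ≈ P * F (i (1 ℕ.+ k)) + Q * F (i k)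
      F-rec₂ k rewrite i-suc (suc k) | i-suc k = F-step₄ (i k)

      balancing-rec₂ : ∀ (u : ℕ → Carrier) → (∀ n → u (2 ℕ.+ n) ≈ ⟦ + 6 ⟧ * x * u (1 ℕ.+ n) - u n) →
        ∀ k → u (i (2 ℕ.+ k)) ≈ P * u (i (1 ℕ.+ k)) + Q * u (i k) + D * u (i (1 ℕ.+ k))
      balancing-rec₂ u u-rec k rewrite i-suc (suc k) | i-suc k = balancing-step₄ u u-rec (i k)

    2[1+k]∸1-suc : ∀ k → 2 ℕ.* (2 ℕ.+ k) ∸ 1 ≡ 2 ℕ.+ (2 ℕ.* suc k ∸ 1)
    2[1+k]∸1-suc k = ≡.cong (_∸ 1) (ℕ.*-suc 2 (suc k))

    2k+1-suc : ∀ k → 2 ℕ.* suc k ℕ.+ 1 ≡ 2 ℕ.+ (2 ℕ.* k ℕ.+ 1)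
    2k+1-suc k = ≡.cong (ℕ._+ 1) (ℕ.*-suc 2 k)

    module 2k     = EveryOther (2 ℕ.*_) (ℕ.*-suc 2)
    module 2k+1   = EveryOther (λ k → 2 ℕ.* k ℕ.+ 1) 2k+1-suc
    module 2[1+k] = EveryOther (λ k → 2 ℕ.* suc k) (λ k → ℕ.*-suc 2 (suc k))
    module 2[1+k]∸1 = EveryOther (λ k → 2 ℕ.* suc k ∸ 1) 2[1+k]∸1-suc

    -- The values at −1, C₋₁ = 3x and B₋₁ = −1, continue the recurrences backwards.
    C₂ₖ₋₁ B₂ₖ₋₁ : ℕ → Carrier
    C₂ₖ₋₁ zero    = t
    C₂ₖ₋₁ (suc k) = C (2 ℕ.* suc k ∸ 1)
    B₂ₖ₋₁ zero    = ⟦ -[1+ 0 ] ⟧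
    B₂ₖ₋₁ (suc k) = B (2 ℕ.* suc k ∸ 1)

    C₂ : C 2 ≈ ⟦ + 6 ⟧ * x * t - ⟦ + 1 ⟧
    C₂ = trans (C-rec 0) (+-cong (*-congˡ C₁) (-‿cong C₀))

    B₂ : B 2 ≈ ⟦ + 6 ⟧ * x * ⟦ + 1 ⟧ - ⟦ + 0 ⟧
    B₂ = trans (B-rec 0) (+-cong (*-congˡ B₁) (-‿cong B₀))

    -- Truncated subtraction would send the index -1 to 0, so `2[1+k]∸1.balancing-rec₂` covers only
    -- k ≥ 1; the instance reaching back to C₋₁ is computed from `C 1` and `C 2`.
    C₂ₖ₋₁-rec : ∀ k → C₂ₖ₋₁ (2 ℕ.+ k) ≈
      P * C₂ₖ₋₁ (1 ℕ.+ k) + Q * C₂ₖ₋₁ k + D * C (2 ℕ.* suc k ∸ 1)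
    C₂ₖ₋₁-rec (suc k) = 2[1+k]∸1.balancing-rec₂ C C-rec k
    C₂ₖ₋₁-rec zero = begin
      C 3                                                       ≈⟨ C-rec 1 ⟩
      ⟦ + 6 ⟧ * x * C 2 - C 1
        ≈⟨ +-cong (*-congˡ C₂) (-‿cong C₁) ⟩
      ⟦ + 6 ⟧ * x * (⟦ + 6 ⟧ * x * t - ⟦ + 1 ⟧) - t
        ≈⟨ solve 1 (λ x → con (+ 6) :* x :* (con (+ 6) :* x :* (con (+ 3) :* x) :- con (+ 1)) :- con (+ 3) :* x :=
             (con (+ 3) :* x :* (con (+ 3) :* x) :+ con (+ 2)) :* (con (+ 3) :* x) :+ con -[1+ 0 ] :* (con (+ 3) :* x)
             :+ (con (+ 27) :* (x :* (x :* con (+ 1))) :- con (+ 4)) :* (con (+ 3) :* x)) refl x ⟩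
      P * t + Q * t + D * t                ≈⟨ +-cong (+-congʳ (*-congˡ C₁)) (*-congˡ C₁) ⟨
      P * C 1 + Q * t + D * C 1            ∎

    B₂ₖ₋₁-rec : ∀ k → B₂ₖ₋₁ (2 ℕ.+ k) ≈
      P * B₂ₖ₋₁ (1 ℕ.+ k) + Q * B₂ₖ₋₁ k + D * B (2 ℕ.* suc k ∸ 1)
    B₂ₖ₋₁-rec (suc k) = 2[1+k]∸1.balancing-rec₂ B B-rec k
    B₂ₖ₋₁-rec zero = begin
      B 3                                                       ≈⟨ B-rec 1 ⟩
      ⟦ + 6 ⟧ * x * B 2 - B 1
        ≈⟨ +-cong (*-congˡ B₂) (-‿cong B₁) ⟩
      ⟦ + 6 ⟧ * x * (⟦ + 6 ⟧ * x * ⟦ + 1 ⟧ - ⟦ + 0 ⟧) - ⟦ + 1 ⟧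
        ≈⟨ solve 1 (λ x → con (+ 6) :* x :* (con (+ 6) :* x :* con (+ 1) :- con (+ 0)) :- con (+ 1) :=
             (con (+ 3) :* x :* (con (+ 3) :* x) :+ con (+ 2)) :* con (+ 1) :+ con -[1+ 0 ] :* con -[1+ 0 ]
             :+ (con (+ 27) :* (x :* (x :* con (+ 1))) :- con (+ 4)) :* con (+ 1)) refl x ⟩
      -- In `Q * Q` the second factor is B₋₁, which is the constant -1 as well.
      P * ⟦ + 1 ⟧ + Q * Q + D * ⟦ + 1 ⟧    ≈⟨ +-cong (+-congʳ (*-congˡ B₁)) (*-congˡ B₁) ⟨
      P * B 1 + Q * Q + D * B 1            ∎

    -- Boundary terms of the convolution.

    boundary : ∀ {a a′ b b′} p {g g′ h h′} → a ≈ a′ → b ≈ b′ → g ≈ g′ → h ≈ h′ →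
      a * g + (b - p * a) * h ≈ a′ * g′ + (b′ - p * a′) * h′
    boundary p a b g h = +-cong (*-cong a g) (*-cong (+-cong b (-‿cong (*-congˡ a))) h)

    F₃ : F 3 ≈ t * t + ⟦ + 1 ⟧
    F₃ = begin
      F 3                                        ≈⟨ F-step₃ 0 ⟩
      (t * t + ⟦ + 1 ⟧) * F 1 + t * F 0          ≈⟨ +-cong (*-congˡ F₁) (*-congˡ F₀) ⟩
      (t * t + ⟦ + 1 ⟧) * ⟦ + 1 ⟧ + t * ⟦ + 0 ⟧
        ≈⟨ solve 1 (λ t → (t :* t :+ con (+ 1)) :* con (+ 1) :+ t :* con (+ 0) := t :* t :+ con (+ 1)) refl t ⟩
      t * t + ⟦ + 1 ⟧                            ∎

    F₄ : F 4 ≈ P * t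
    F₄ = begin
      F 4                    ≈⟨ F-step₄ 0 ⟩
      P * F 2 + Q * F 0      ≈⟨ +-cong (*-congˡ F₂) (*-congˡ F₀) ⟩
      P * t + Q * ⟦ + 0 ⟧    ≈⟨ solve 2 (λ y q → y :+ q :* con (+ 0) := y) refl (P * t) Q ⟩
      P * t                  ∎

    -- By `F-step₃` the bracket is `t * F m - F i`; as C₁ = C₋₁ = `t`, the terms in `F i` cancel and
    -- t² `F m` remains. The index equations let the lemma serve both parities of `m`.
    tail-C : ∀ {m i j} → i ≡ 1 ℕ.+ m → j ≡ 3 ℕ.+ m →
      F i * C 1 + (F j - P * F i) * t ≈ ⟦ + 9 ⟧ * x² * F m
    tail-C {m} ≡.refl ≡.refl = begin
      F (1 ℕ.+ m) * C 1 + (F (3 ℕ.+ m) - P * F (1 ℕ.+ m)) * t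
        ≈⟨ boundary P refl (F-step₃ m) C₁ refl ⟩
      F (1 ℕ.+ m) * t + ((t * t + ⟦ + 1 ⟧) * F (1 ℕ.+ m) + t * F m - P * F (1 ℕ.+ m)) * t
        ≈⟨ solve 3 (λ x y z → let t = con (+ 3) :* x in
             z :* t :+ ((t :* t :+ con (+ 1)) :* z :+ t :* y :- (t :* t :+ con (+ 2)) :* z) :* t :=
             con (+ 9) :* (x :* (x :* con (+ 1))) :* y) refl x (F m) (F (1 ℕ.+ m)) ⟩
      ⟦ + 9 ⟧ * x² * F m ∎

    tail-B : ∀ y z → y * B 2 + z * B 0 ≈ ⟦ + 6 ⟧ * x * y
    tail-B y z = begin
      y * B 2 + z * B 0      ≈⟨ +-cong (*-congˡ B₂) (*-congˡ B₀) ⟩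
      y * (⟦ + 6 ⟧ * x * ⟦ + 1 ⟧ - ⟦ + 0 ⟧) + z * ⟦ + 0 ⟧
        ≈⟨ solve 3 (λ x y z → y :* (con (+ 6) :* x :* con (+ 1) :- con (+ 0)) :+ z :* con (+ 0) :=
             con (+ 6) :* x :* y) refl x y z ⟩
      ⟦ + 6 ⟧ * x * y        ∎

    -- The trailing `Q` is B₋₁ = -1. By `F-step₄` the bracket is `Q * F m`, and the two signs
    -- cancel.
    tail-B-odd : ∀ {m i j} → i ≡ 2 ℕ.+ m → j ≡ 4 ℕ.+ m →
      F i * B 1 + (F j - P * F i) * Q ≈ F i + F m
    tail-B-odd {m} ≡.refl ≡.refl = begin
      F (2 ℕ.+ m) * B 1 + (F (4 ℕ.+ m) - P * F (2 ℕ.+ m)) * Q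
        ≈⟨ boundary P refl (F-step₄ m) B₁ refl ⟩
      F (2 ℕ.+ m) * ⟦ + 1 ⟧ + (P * F (2 ℕ.+ m) + Q * F m - P * F (2 ℕ.+ m)) * Q
        ≈⟨ solve 3 (λ p y z →
             z :* con (+ 1) :+ (p :* z :+ con -[1+ 0 ] :* y :- p :* z) :* con -[1+ 0 ] :=
             z :+ y) refl P (F m) (F (2 ℕ.+ m)) ⟩
      F (2 ℕ.+ m) + F m ∎

    -- The bracket is the second coefficient of the recurrence times the term preceding the first:
    -- here -F₋₁ = -1, while in `head-even` and `head-all` that term is `F 0` and vanishes.
    head-odd : ∀ {g g′} h → g ≡ g′ → F 1 * g + (F 3 - P * F 1) * h ≈ g′ - h
    head-odd {g} h ≡.refl = begin
      F 1 * g + (F 3 - P * F 1) * h        ≈⟨ boundary P F₁ F₃ refl refl ⟩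
      ⟦ + 1 ⟧ * g + (t * t + ⟦ + 1 ⟧ - P * ⟦ + 1 ⟧) * h
        ≈⟨ solve 3 (λ t g h → con (+ 1) :* g :+ (t :* t :+ con (+ 1) :- (t :* t :+ con (+ 2)) :* con (+ 1)) :* h :=
             g :- h) refl t g h ⟩
      g - h ∎

    head-even : ∀ g h → F 2 * g + (F 4 - P * F 2) * h ≈ t * g
    head-even g h = begin
      F 2 * g + (F 4 - P * F 2) * h  ≈⟨ boundary P F₂ F₄ refl refl ⟩
      t * g + (P * t - P * t) * h
        ≈⟨ solve 4 (λ t p g h → t :* g :+ (p :* t :- p :* t) :* h := t :* g) refl t P g h ⟩
      t * g                          ∎

    head-all : ∀ g h → F 1 * g + (F 2 - t * F 1) * h ≈ g
    head-all g h = begin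
      F 1 * g + (F 2 - t * F 1) * h  ≈⟨ boundary t F₁ F₂ refl refl ⟩
      ⟦ + 1 ⟧ * g + (t - t * ⟦ + 1 ⟧) * h
        ≈⟨ solve 3 (λ t g h → con (+ 1) :* g :+ (t :- t :* con (+ 1)) :* h := g) refl t g h ⟩
      g                              ∎

    -- The seven identities over a commutative ring.

    F-rec₁ : ∀ n → F (2 ℕ.+ n) ≈ t * F (1 ℕ.+ n) + ⟦ + 1 ⟧ * F n
    F-rec₁ n = trans (F-rec n) (+-congˡ (solve 1 (λ y → y := con (+ 1) :* y) refl (F n)))

    balancing-defect : ∀ (u : ℕ → Carrier) n → u (2 ℕ.+ n) ≈ ⟦ + 6 ⟧ * x * u (1 ℕ.+ n) - u n →
      u (2 ℕ.+ n) ≈ t * u (1 ℕ.+ n) + ⟦ + 1 ⟧ * u n + ⟦ + 1 ⟧ * (t * u (1 ℕ.+ n) - ⟦ + 2 ⟧ * u n)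
    balancing-defect u n u-rec = trans u-rec
      (solve 3 (λ x y z → let t = con (+ 3) :* x in
         con (+ 6) :* x :* z :- y :=
         t :* z :+ con (+ 1) :* y :+ con (+ 1) :* (t :* z :- con (+ 2) :* y))
         refl x (u n) (u (1 ℕ.+ n)))

    minus-1* : ∀ v s → v - ⟦ + 1 ⟧ * s ≈ v - s
    minus-1* = solve 2 (λ v s → v :- con (+ 1) :* s := v :- s) refl

    -- The index starts at 2 because a convolution of length `n` along `F ∘ suc` ends at
    -- `F (2 + n)`. The boundary values C₀ = 1 and C₁ = `t` make the two terms in `F (1 + n)`
    -- cancel.
    F-via-C : ∀ n → F (2 ℕ.+ n) ≈
      C (1 ℕ.+ n) - sum n (λ k → (t * C (suc n ∸ k ∸ 1) - ⟦ + 2 ⟧ * C (suc n ∸ k ∸ 2)) * F (1 ℕ.+ k))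
    F-via-C n = trans
      (convolution-difference n (F ∘ suc) (F-rec₁ ∘ suc)
        (begin
          F (1 ℕ.+ n) * C 1 + (F (2 ℕ.+ n) - t * F (1 ℕ.+ n)) * C 0
            ≈⟨ boundary t refl refl C₁ C₀ ⟩
          F (1 ℕ.+ n) * t + (F (2 ℕ.+ n) - t * F (1 ℕ.+ n)) * ⟦ + 1 ⟧
            ≈⟨ solve 3 (λ t y z → y :* t :+ (z :- t :* y) :* con (+ 1) := z) refl t _ _ ⟩
          F (2 ℕ.+ n) ∎)
        (head-all _ _))
      (minus-1* _ _)
      where
      open Convolution t ⟦ + 1 ⟧ ⟦ + 1 ⟧ C (λ n k → t * C (suc n ∸ k ∸ 1) - ⟦ + 2 ⟧ * C (suc n ∸ k ∸ 2))
        (λ n → balancing-defect C n (C-rec n)) (λ _ _ → ≡.refl)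

    -- Shifting the balancing sequence by one makes the boundary values B₁ = 1 and B₂ = 2t; the
    -- surplus `t` yields the summand `t * F (1 + n)`.
    F-via-B : ∀ n → F (2 ℕ.+ n) + t * F (1 ℕ.+ n) ≈
      B (2 ℕ.+ n) - sum n (λ k → (t * B (suc n ∸ k) - ⟦ + 2 ⟧ * B (suc n ∸ k ∸ 1)) * F (1 ℕ.+ k))
    F-via-B n = trans
      (convolution-difference n (F ∘ suc) (F-rec₁ ∘ suc)
        (begin
          F (1 ℕ.+ n) * B 2 + (F (2 ℕ.+ n) - t * F (1 ℕ.+ n)) * B 1
            ≈⟨ boundary t refl refl B₂ B₁ ⟩
          F (1 ℕ.+ n) * (⟦ + 6 ⟧ * x * ⟦ + 1 ⟧ - ⟦ + 0 ⟧) + (F (2 ℕ.+ n) - t * F (1 ℕ.+ n)) * ⟦ + 1 ⟧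
            ≈⟨ solve 3 (λ x y z → let t = con (+ 3) :* x in
                 y :* (con (+ 6) :* x :* con (+ 1) :- con (+ 0)) :+ (z :- t :* y) :* con (+ 1) := z :+ t :* y)
                 refl x _ _ ⟩
          F (2 ℕ.+ n) + t * F (1 ℕ.+ n) ∎)
        (head-all _ _))
      (minus-1* _ _)
      where
      open Convolution t ⟦ + 1 ⟧ ⟦ + 1 ⟧ (B ∘ suc) (λ n k → t * B (suc n ∸ k) - ⟦ + 2 ⟧ * B (suc n ∸ k ∸ 1))
        (λ n → balancing-defect (B ∘ suc) n (B-rec (suc n))) (λ _ _ → ≡.refl)

    -- With the index written through `n ∸ k`, `h-shift` holds by computation. The sums meet only k
    -- < n, so the truncated case `n ∸ k` = 0 never enters them; the value at -1 enters through
    -- `G 0` alone.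
    module C-odd  = Convolution P Q D C₂ₖ₋₁ (λ n k → C (2 ℕ.* (n ∸ k) ∸ 1)) C₂ₖ₋₁-rec (λ _ _ → ≡.refl)
    module B-odd  = Convolution P Q D B₂ₖ₋₁ (λ n k → B (2 ℕ.* (n ∸ k) ∸ 1)) B₂ₖ₋₁-rec (λ _ _ → ≡.refl)
    module B-even = Convolution P Q D (λ k → B (2 ℕ.* k)) (λ n k → B (2 ℕ.* (n ∸ k)))
      (2k.balancing-rec₂ B B-rec) (λ _ _ → ≡.refl)

    F-even-via-C : ∀ n → ⟦ + 9 ⟧ * x² * F (2 ℕ.* suc n) ≈
      C (2 ℕ.* suc n ℕ.+ 1) - C (2 ℕ.* suc n ∸ 1)
        - D * sum (suc n) (λ k → C (2 ℕ.* (suc n ∸ k) ∸ 1) * F (2 ℕ.* k ℕ.+ 1))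
    F-even-via-C n = C-odd.convolution-difference (suc n) (λ k → F (2 ℕ.* k ℕ.+ 1)) 2k+1.F-rec₂
      (tail-C 2[1+n]+1 (≡.trans (2k+1-suc (suc n)) (≡.cong (2 ℕ.+_) 2[1+n]+1)))
      (head-odd _ (≡.cong C (≡.trans (2[1+k]∸1-suc n) (≡.sym 2[1+n]+1))))
      where
      2[1+n]+1 : 2 ℕ.* suc n ℕ.+ 1 ≡ 1 ℕ.+ 2 ℕ.* suc n
      2[1+n]+1 = ℕ.+-comm (2 ℕ.* suc n) 1

    F-odd-via-B : ∀ n → ⟦ + 6 ⟧ * x * F (2 ℕ.* suc n ℕ.+ 1) ≈
      B (2 ℕ.* (suc n ℕ.+ 1)) - B (2 ℕ.* suc n)
        - D * sum (suc n) (λ k → B (2 ℕ.* (suc n ∸ k)) * F (2 ℕ.* k ℕ.+ 1))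
    F-odd-via-B n = B-even.convolution-difference (suc n) (λ k → F (2 ℕ.* k ℕ.+ 1)) 2k+1.F-rec₂
      (tail-B _ _)
      (head-odd _ (≡.cong (λ m → B (2 ℕ.* m)) (ℕ.+-comm 1 (suc n))))

    -- Here and in the next two identities the even-indexed terms start at `F 2`, so the convolution
    -- has length `n` instead of `suc n`, and its head is a single product.
    F-even-via-B-odd : ∀ n → F (2 ℕ.* suc n) + F (2 ℕ.* suc n ∸ 2) ≈
      t * B (2 ℕ.* suc n ∸ 1)
        - D * sum n (λ k → B (2 ℕ.* (n ∸ k) ∸ 1) * F (2 ℕ.* suc k))
    F-even-via-B-odd n = B-odd.convolution-difference n (λ k → F (2 ℕ.* suc k)) 2[1+k].F-rec₂
      (tail-B-odd 2[1+n] (≡.trans (ℕ.*-suc 2 (suc n)) (≡.cong (2 ℕ.+_) 2[1+n])))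
      (head-even _ _)
      where
      2[1+n] : 2 ℕ.* suc n ≡ 2 ℕ.+ (2 ℕ.* suc n ∸ 2)
      2[1+n] = ≡.sym (ℕ.m+[n∸m]≡n (ℕ.*-monoʳ-≤ 2 (ℕ.s≤s ℕ.z≤n)))

    F-odd-via-C : ∀ n → ⟦ + 9 ⟧ * x² * F (2 ℕ.* suc n ∸ 1) ≈
      t * C (2 ℕ.* suc n ∸ 1)
        - D * sum n (λ k → C (2 ℕ.* (n ∸ k) ∸ 1) * F (2 ℕ.* suc k))
    F-odd-via-C n = C-odd.convolution-difference n (λ k → F (2 ℕ.* suc k)) 2[1+k].F-rec₂
      (tail-C ≡.refl (ℕ.*-suc 2 (suc n)))
      (head-even _ _)

    F-even-via-B : ∀ n → ⟦ + 6 ⟧ * x * F (2 ℕ.* suc n) ≈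
      t * B (2 ℕ.* suc n)
        - D * sum n (λ k → B (2 ℕ.* (n ∸ k)) * F (2 ℕ.* suc k))
    F-even-via-B n = B-even.convolution-difference n (λ k → F (2 ℕ.* suc k)) 2[1+k].F-rec₂
      (tail-B _ _)
      (head-even _ _)

-- The commutative ring of coefficient lists.

open import Defs
open import Data.Nat using (_+_; _*_; _≤_)

open ℤ.+-*-Solver using (solve; con; _:=_; _:+_; _:*_)

coeff-+ : ∀ p q i → coeff (p +ₚ q) i ≡ coeff p i ℤ.+ coeff q i
coeff-+ []      q       i       = ≡.sym (ℤ.+-identityˡ _)
coeff-+ (a ∷ p) []      i       = ≡.sym (ℤ.+-identityʳ _)
coeff-+ (a ∷ p) (b ∷ q) zero    = ≡.refl
coeff-+ (a ∷ p) (b ∷ q) (suc i) = coeff-+ p q i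

coeff-neg : ∀ p i → coeff (-ₚ p) i ≡ ℤ.- coeff p i
coeff-neg []      i       = ≡.refl
coeff-neg (a ∷ p) zero    = ≡.refl
coeff-neg (a ∷ p) (suc i) = coeff-neg p i

coeff-scale : ∀ a p i → coeff (map (a ℤ.*_) p) i ≡ a ℤ.* coeff p i
coeff-scale a []      i       = ≡.sym (ℤ.*-zeroʳ a)
coeff-scale a (b ∷ p) zero    = ≡.refl
coeff-scale a (b ∷ p) (suc i) = coeff-scale a p i

coeff-*-∷ : ∀ a p q i → coeff ((a ∷ p) *ₚ q) i ≡ a ℤ.* coeff q i ℤ.+ coeff (0ℤ ∷ p *ₚ q) i
coeff-*-∷ a p q i = ≡.trans (coeff-+ (map (a ℤ.*_) q) _ i) (≡.cong (ℤ._+ _) (coeff-scale a q i))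

∷-cong : ∀ a p q → p ≈ q → a ∷ p ≈ a ∷ q
∷-cong a p q p≈q zero    = ≡.refl
∷-cong a p q p≈q (suc i) = p≈q i

+-cong : ∀ {p p′ q q′} → p ≈ p′ → q ≈ q′ → p +ₚ q ≈ p′ +ₚ q′
+-cong {p} {p′} {q} {q′} p≈p′ q≈q′ i = begin
  coeff (p +ₚ q) i            ≡⟨ coeff-+ p q i ⟩
  coeff p i ℤ.+ coeff q i     ≡⟨ ≡.cong₂ ℤ._+_ (p≈p′ i) (q≈q′ i) ⟩
  coeff p′ i ℤ.+ coeff q′ i   ≡⟨ coeff-+ p′ q′ i ⟨
  coeff (p′ +ₚ q′) i          ∎
  where open ≡.≡-Reasoning

+-congˡ : ∀ p q r → q ≈ r → p +ₚ q ≈ p +ₚ r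
+-congˡ p q r q≈r = +-cong {p} {p} {q} {r} (λ _ → ≡.refl) q≈r

+-congʳ : ∀ p q r → q ≈ r → q +ₚ p ≈ r +ₚ p
+-congʳ p q r q≈r = +-cong {q} {r} {p} {p} q≈r (λ _ → ≡.refl)

+-assoc : ∀ p q r → (p +ₚ q) +ₚ r ≈ p +ₚ (q +ₚ r)
+-assoc p q r i
  rewrite coeff-+ (p +ₚ q) r i | coeff-+ p q i | coeff-+ p (q +ₚ r) i | coeff-+ q r i
  = ℤ.+-assoc (coeff p i) (coeff q i) (coeff r i)

+-comm : ∀ p q → p +ₚ q ≈ q +ₚ p
+-comm p q i rewrite coeff-+ p q i | coeff-+ q p i = ℤ.+-comm (coeff p i) (coeff q i)

+-identityʳ : ∀ p → p +ₚ 0ₚ ≈ p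
+-identityʳ p i = ≡.trans (coeff-+ p 0ₚ i) (ℤ.+-identityʳ _)

-ₚ-cong : ∀ {p q} → p ≈ q → -ₚ p ≈ -ₚ q
-ₚ-cong {p} {q} p≈q i rewrite coeff-neg p i | coeff-neg q i = ≡.cong ℤ.-_ (p≈q i)

-ₚ-inverseˡ : ∀ p → -ₚ p +ₚ p ≈ 0ₚ
-ₚ-inverseˡ p i rewrite coeff-+ (-ₚ p) p i | coeff-neg p i = ℤ.+-inverseˡ (coeff p i)

-ₚ-inverseʳ : ∀ p → p +ₚ -ₚ p ≈ 0ₚ
-ₚ-inverseʳ p i rewrite coeff-+ p (-ₚ p) i | coeff-neg p i = ℤ.+-inverseʳ (coeff p i)

*-congˡ : ∀ p q r → q ≈ r → p *ₚ q ≈ p *ₚ r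
*-congˡ []      q r q≈r i = ≡.refl
*-congˡ (a ∷ p) q r q≈r i rewrite coeff-*-∷ a p q i | coeff-*-∷ a p r i =
  ≡.cong₂ (λ u v → a ℤ.* u ℤ.+ v) (q≈r i) (∷-cong 0ℤ (p *ₚ q) (p *ₚ r) (*-congˡ p q r q≈r) i)

*-zeroʳ : ∀ p → p *ₚ 0ₚ ≈ 0ₚ
*-zeroʳ []      i       = ≡.refl
*-zeroʳ (a ∷ p) zero    = ≡.refl
*-zeroʳ (a ∷ p) (suc i) = *-zeroʳ p i

-- `_*ₚ_` recurses on its left factor; the matching recursion in the right factor is the inductive
-- step of `*-comm`.
*-∷ : ∀ p b q → p *ₚ (b ∷ q) ≈ map (b ℤ.*_) p +ₚ (0ℤ ∷ p *ₚ q)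
*-∷ []      b q zero    = ≡.refl
*-∷ []      b q (suc i) = ≡.refl
*-∷ (a ∷ p) b q zero    = ≡.cong (ℤ._+ 0ℤ) (ℤ.*-comm a b)
*-∷ (a ∷ p) b q (suc i)
  rewrite coeff-+ (map (a ℤ.*_) q) (p *ₚ (b ∷ q)) i
        | *-∷ p b q i
        | coeff-+ (map (b ℤ.*_) p) (0ℤ ∷ p *ₚ q) i
        | coeff-+ (map (b ℤ.*_) p) ((a ∷ p) *ₚ q) i
        | coeff-+ (map (a ℤ.*_) q) (0ℤ ∷ p *ₚ q) i
  = solve 3 (λ u v w → u :+ (v :+ w) := v :+ (u :+ w)) ≡.refl
      (coeff (map (a ℤ.*_) q) i) (coeff (map (b ℤ.*_) p) i) _

*-comm : ∀ p q → p *ₚ q ≈ q *ₚ p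
*-comm []      q i = ≡.sym (*-zeroʳ q i)
*-comm (a ∷ p) q i = ≡.trans
  (+-congˡ (map (a ℤ.*_) q) (0ℤ ∷ p *ₚ q) (0ℤ ∷ q *ₚ p) (∷-cong 0ℤ (p *ₚ q) (q *ₚ p) (*-comm p q)) i)
  (≡.sym (*-∷ q a p i))

*-cong : ∀ {p p′ q q′} → p ≈ p′ → q ≈ q′ → p *ₚ q ≈ p′ *ₚ q′
*-cong {p} {p′} {q} {q′} p≈p′ q≈q′ i = begin
  coeff (p *ₚ q) i    ≡⟨ *-congˡ p q q′ q≈q′ i ⟩
  coeff (p *ₚ q′) i   ≡⟨ *-comm p q′ i ⟩
  coeff (q′ *ₚ p) i   ≡⟨ *-congˡ q′ p p′ p≈p′ i ⟩
  coeff (q′ *ₚ p′) i  ≡⟨ *-comm q′ p′ i ⟩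
  coeff (p′ *ₚ q′) i  ∎
  where open ≡.≡-Reasoning

*-distribˡ-+ : ∀ p q r → p *ₚ (q +ₚ r) ≈ p *ₚ q +ₚ p *ₚ r
*-distribˡ-+ []      q r i = ≡.refl
*-distribˡ-+ (a ∷ p) q r i
  rewrite coeff-*-∷ a p (q +ₚ r) i | coeff-+ q r i
        | ∷-cong 0ℤ (p *ₚ (q +ₚ r)) (p *ₚ q +ₚ p *ₚ r) (*-distribˡ-+ p q r) i | coeff-+ (0ℤ ∷ p *ₚ q) (0ℤ ∷ p *ₚ r) i
        | coeff-+ ((a ∷ p) *ₚ q) ((a ∷ p) *ₚ r) i | coeff-*-∷ a p q i | coeff-*-∷ a p r i
  = solve 5 (λ a q r u v → a :* (q :+ r) :+ (u :+ v) := a :* q :+ u :+ (a :* r :+ v)) ≡.refl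
      a (coeff q i) (coeff r i) (coeff (0ℤ ∷ p *ₚ q) i) (coeff (0ℤ ∷ p *ₚ r) i)

*-distribʳ-+ : ∀ r p q → (p +ₚ q) *ₚ r ≈ p *ₚ r +ₚ q *ₚ r
*-distribʳ-+ r p q i = begin
  coeff ((p +ₚ q) *ₚ r) i      ≡⟨ *-comm (p +ₚ q) r i ⟩
  coeff (r *ₚ (p +ₚ q)) i      ≡⟨ *-distribˡ-+ r p q i ⟩
  coeff (r *ₚ p +ₚ r *ₚ q) i   ≡⟨ +-cong {r *ₚ p} {p *ₚ r} {r *ₚ q} {q *ₚ r} (*-comm r p) (*-comm r q) i ⟩
  coeff (p *ₚ r +ₚ q *ₚ r) i   ∎
  where open ≡.≡-Reasoning

-- `*-assoc` splits a left factor into a constant part and a multiple of x; this lemma moves the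
-- constant out of a product, and `0∷-*` moves the x out.
scale-* : ∀ a p q → map (a ℤ.*_) p *ₚ q ≈ map (a ℤ.*_) (p *ₚ q)
scale-* a []      q i = ≡.refl
scale-* a (b ∷ p) q i
  rewrite coeff-*-∷ (a ℤ.* b) (map (a ℤ.*_) p) q i | ∷-cong 0ℤ (map (a ℤ.*_) p *ₚ q) (map (a ℤ.*_) (p *ₚ q)) (scale-* a p q) i
        | coeff-scale a ((b ∷ p) *ₚ q) i | coeff-*-∷ b p q i
  with i
... | zero  = solve 3 (λ a b q → a :* b :* q :+ con 0ℤ := a :* (b :* q :+ con 0ℤ)) ≡.refl a b (coeff q 0)
... | suc j rewrite coeff-scale a (p *ₚ q) j =
  solve 4 (λ a b q u → a :* b :* q :+ a :* u := a :* (b :* q :+ u)) ≡.refl a b (coeff q (suc j)) (coeff (p *ₚ q) j)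

0∷-* : ∀ p q → (0ℤ ∷ p) *ₚ q ≈ 0ℤ ∷ p *ₚ q
0∷-* p q i = ≡.trans (coeff-*-∷ 0ℤ p q i) (ℤ.+-identityˡ _)

*-assoc : ∀ p q r → (p *ₚ q) *ₚ r ≈ p *ₚ (q *ₚ r)
*-assoc []      q r i = ≡.refl
*-assoc (a ∷ p) q r i = begin
  coeff (((a ∷ p) *ₚ q) *ₚ r) i
    ≡⟨ *-distribʳ-+ r (map (a ℤ.*_) q) (0ℤ ∷ p *ₚ q) i ⟩
  coeff (map (a ℤ.*_) q *ₚ r +ₚ (0ℤ ∷ p *ₚ q) *ₚ r) i
    ≡⟨ +-cong {map (a ℤ.*_) q *ₚ r} {map (a ℤ.*_) (q *ₚ r)} {(0ℤ ∷ p *ₚ q) *ₚ r} {0ℤ ∷ (p *ₚ q) *ₚ r}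
         (scale-* a q r) (0∷-* (p *ₚ q) r) i ⟩
  coeff (map (a ℤ.*_) (q *ₚ r) +ₚ (0ℤ ∷ (p *ₚ q) *ₚ r)) i
    ≡⟨ +-congˡ (map (a ℤ.*_) (q *ₚ r)) (0ℤ ∷ (p *ₚ q) *ₚ r) (0ℤ ∷ p *ₚ (q *ₚ r))
         (∷-cong 0ℤ ((p *ₚ q) *ₚ r) (p *ₚ (q *ₚ r)) (*-assoc p q r)) i ⟩
  coeff ((a ∷ p) *ₚ (q *ₚ r)) i ∎
  where open ≡.≡-Reasoning

-- `# 0` is a list with one zero entry and `0ₚ` is empty; they differ by a trailing zero, which
-- `_≈_` ignores.
#0≈0 : # 0 ≈ 0ₚ
#0≈0 zero    = ≡.refl
#0≈0 (suc i) = ≡.refl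

*-identityˡ : ∀ p → # 1 *ₚ p ≈ p
*-identityˡ p i = begin
  coeff (# 1 *ₚ p) i                      ≡⟨ coeff-*-∷ 1ℤ [] p i ⟩
  1ℤ ℤ.* coeff p i ℤ.+ coeff (# 0) i      ≡⟨ ≡.cong₂ ℤ._+_ (ℤ.*-identityˡ (coeff p i)) (#0≈0 i) ⟩
  coeff p i ℤ.+ 0ℤ                        ≡⟨ ℤ.+-identityʳ (coeff p i) ⟩
  coeff p i                               ∎
  where open ≡.≡-Reasoning

ℤ[x]-isCommutativeRing : IsCommutativeRing _≈_ _+ₚ_ _*ₚ_ -ₚ_ 0ₚ (# 1)
ℤ[x]-isCommutativeRing = record
  { isRing = record
    { +-isAbelianGroup = record
      { isGroup = record
        { isMonoid = record
          { isSemigroup = record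
            { isMagma = record
              { isEquivalence = record
                { refl  = λ _ → ≡.refl
                ; sym   = λ p≈q i → ≡.sym (p≈q i)
                ; trans = λ p≈q q≈r i → ≡.trans (p≈q i) (q≈r i)
                }
              ; ∙-cong = λ {p} {p′} {q} {q′} → +-cong {p} {p′} {q} {q′}
              }
            ; assoc = +-assoc
            }
          ; identity = (λ _ _ → ≡.refl) , +-identityʳ
          }
        ; inverse = -ₚ-inverseˡ , -ₚ-inverseʳ
        ; ⁻¹-cong = λ {p} {q} → -ₚ-cong {p} {q}
        }
      ; comm = +-comm
      }
    ; *-cong     = λ {p} {p′} {q} {q′} → *-cong {p} {p′} {q} {q′}
    ; *-assoc    = *-assoc
    ; *-identity = *-identityˡ , λ p i → ≡.trans (*-comm p (# 1) i) (*-identityˡ p i)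
    ; distrib    = *-distribˡ-+ , *-distribʳ-+
    }
  ; *-comm = *-comm
  }

ℤ[x]-commutativeRing : CommutativeRing _ _
ℤ[x]-commutativeRing = record { isCommutativeRing = ℤ[x]-isCommutativeRing }

const-homomorphism : +-*-rawRing -Raw-AlmostCommutative⟶ fromCommutativeRing ℤ[x]-commutativeRing
const-homomorphism = record
  { ⟦_⟧    = const
  ; +-homo = λ _ _ _ → ≡.refl
  -- The product of two constants adds a shifted empty product, which leaves a summand `0ℤ` in the
  -- constant term.
  ; *-homo = λ a b → λ where
      zero    → ≡.sym (ℤ.+-identityʳ (a ℤ.* b))
      (suc i) → ≡.refl
  ; -‿homo = λ _ _ → ≡.refl
  ; 0-homo = #0≈0
  ; 1-homo = λ _ → ≡.refl
  }

open CommutativeRing ℤ[x]-commutativeRing using (setoid; +-commutativeSemigroup)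
open CommutativeSemigroup +-commutativeSemigroup using (interchange)

-- Substitution into a polynomial.

module _ (r : ℤ[x]) where

  open SetoidReasoning setoid

  ⟨⟩-+ : ∀ p q → (p +ₚ q) ⟨ r ⟩ ≈ p ⟨ r ⟩ +ₚ q ⟨ r ⟩
  ⟨⟩-+ []      q       i = ≡.refl
  ⟨⟩-+ (a ∷ p) []      i = ≡.sym (+-identityʳ ((a ∷ p) ⟨ r ⟩) i)
  ⟨⟩-+ (a ∷ p) (b ∷ q) = begin
    const (a ℤ.+ b) +ₚ r *ₚ (p +ₚ q) ⟨ r ⟩
      ≈⟨ +-congˡ (const (a ℤ.+ b)) (r *ₚ (p +ₚ q) ⟨ r ⟩) (r *ₚ (p ⟨ r ⟩ +ₚ q ⟨ r ⟩))
           (*-congˡ r ((p +ₚ q) ⟨ r ⟩) (p ⟨ r ⟩ +ₚ q ⟨ r ⟩) (⟨⟩-+ p q)) ⟩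
    const a +ₚ const b +ₚ r *ₚ (p ⟨ r ⟩ +ₚ q ⟨ r ⟩)
      ≈⟨ +-congˡ (const (a ℤ.+ b)) (r *ₚ (p ⟨ r ⟩ +ₚ q ⟨ r ⟩)) (r *ₚ p ⟨ r ⟩ +ₚ r *ₚ q ⟨ r ⟩)
           (*-distribˡ-+ r (p ⟨ r ⟩) (q ⟨ r ⟩)) ⟩
    const a +ₚ const b +ₚ (r *ₚ p ⟨ r ⟩ +ₚ r *ₚ q ⟨ r ⟩)
      ≈⟨ interchange (const a) (const b) (r *ₚ p ⟨ r ⟩) (r *ₚ q ⟨ r ⟩) ⟩
    const a +ₚ r *ₚ p ⟨ r ⟩ +ₚ (const b +ₚ r *ₚ q ⟨ r ⟩) ∎

  -- A polynomial equal to `0ₚ` may still be a nonempty list of zeros. In `⟨⟩-cong` this disposes of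
  -- the excess entries of the longer list.
  ⟨⟩-zero : ∀ p → p ≈ 0ₚ → p ⟨ r ⟩ ≈ 0ₚ
  ⟨⟩-zero []      _   = λ _ → ≡.refl
  ⟨⟩-zero (a ∷ p) p≈0 rewrite p≈0 0 = begin
    # 0 +ₚ r *ₚ p ⟨ r ⟩  ≈⟨ +-congʳ (r *ₚ p ⟨ r ⟩) (# 0) 0ₚ #0≈0 ⟩
    r *ₚ p ⟨ r ⟩         ≈⟨ *-congˡ r (p ⟨ r ⟩) 0ₚ (⟨⟩-zero p (p≈0 ∘ suc)) ⟩
    r *ₚ 0ₚ              ≈⟨ *-zeroʳ r ⟩
    0ₚ                   ∎

  ⟨⟩-cong : ∀ p q → p ≈ q → p ⟨ r ⟩ ≈ q ⟨ r ⟩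
  ⟨⟩-cong []      q       p≈q i = ≡.sym (⟨⟩-zero q (≡.sym ∘ p≈q) i)
  ⟨⟩-cong (a ∷ p) []      p≈q = ⟨⟩-zero (a ∷ p) p≈q
  ⟨⟩-cong (a ∷ p) (b ∷ q) p≈q rewrite p≈q 0 =
    +-congˡ (const b) (r *ₚ p ⟨ r ⟩) (r *ₚ q ⟨ r ⟩)
      (*-congˡ r (p ⟨ r ⟩) (q ⟨ r ⟩) (⟨⟩-cong p q (p≈q ∘ suc)))

  -- Since `x` is `0ℤ ∷ # 1`, multiplication by it shifts the list up to `_≈_`, and one Horner step
  -- turns the shift into a factor `r`.
  ⟨⟩-x* : ∀ p → (x *ₚ p) ⟨ r ⟩ ≈ r *ₚ p ⟨ r ⟩
  ⟨⟩-x* p = begin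
    (x *ₚ p) ⟨ r ⟩       ≈⟨ ⟨⟩-cong (x *ₚ p) (0ℤ ∷ # 1 *ₚ p) (0∷-* (# 1) p) ⟩
    (0ℤ ∷ # 1 *ₚ p) ⟨ r ⟩
      ≈⟨ ⟨⟩-cong (0ℤ ∷ # 1 *ₚ p) (0ℤ ∷ p) (∷-cong 0ℤ (# 1 *ₚ p) p (*-identityˡ p)) ⟩
    # 0 +ₚ r *ₚ p ⟨ r ⟩  ≈⟨ +-congʳ (r *ₚ p ⟨ r ⟩) (# 0) 0ₚ #0≈0 ⟩
    r *ₚ p ⟨ r ⟩         ∎

  ⟨⟩-const : ∀ a → const a ⟨ r ⟩ ≈ const a
  ⟨⟩-const a = begin
    const a +ₚ r *ₚ 0ₚ  ≈⟨ +-congˡ (const a) (r *ₚ 0ₚ) 0ₚ (*-zeroʳ r) ⟩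
    const a             ∎

  -- The recurrence is built from addition and multiplication by `x`, which `⟨⟩-+` and `⟨⟩-x*` carry
  -- through substitution.
  F⟨⟩-rec : ∀ n → F (2 + n) ⟨ r ⟩ ≈ r *ₚ F (1 + n) ⟨ r ⟩ +ₚ F n ⟨ r ⟩
  F⟨⟩-rec n = begin
    (x *ₚ F (1 + n) +ₚ F n) ⟨ r ⟩          ≈⟨ ⟨⟩-+ (x *ₚ F (1 + n)) (F n) ⟩
    (x *ₚ F (1 + n)) ⟨ r ⟩ +ₚ F n ⟨ r ⟩
      ≈⟨ +-congʳ (F n ⟨ r ⟩) ((x *ₚ F (1 + n)) ⟨ r ⟩) (r *ₚ F (1 + n) ⟨ r ⟩) (⟨⟩-x* (F (1 + n))) ⟩
    r *ₚ F (1 + n) ⟨ r ⟩ +ₚ F n ⟨ r ⟩      ∎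

-- Specialisation to ℤ[x].

open Identities.FibonacciBalancing ℤ[x]-commutativeRing const-homomorphism
  x (λ n → F n ⟨ 3x ⟩) B C
  (λ i → ≡.sym (#0≈0 i)) (⟨⟩-const 3x 1ℤ) (F⟨⟩-rec 3x)
  -- `B` and `C` satisfy their recurrences by definition; only the empty list `B 0` has to be
  -- identified with `# 0`.
  (λ i → ≡.sym (#0≈0 i)) (λ _ → ≡.refl) (λ _ _ → ≡.refl)
  (λ _ → ≡.refl) (λ _ → ≡.refl) (λ _ _ → ≡.refl)

corollary4 : (n : ℕ) → 1 ≤ n →
    (F n ⟨ 3x ⟩
    ≈ C (n ∸ 1)
    -ₚ (∑[ k ∈ 1 ⋯ n ∸ 2 ] ((3x *ₚ C (n ∸ k ∸ 1) -ₚ # 2 *ₚ C (n ∸ k ∸ 2)) *ₚ F k ⟨ 3x ⟩)))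
    × (F n ⟨ 3x ⟩ +ₚ 3x *ₚ F (n ∸ 1) ⟨ 3x ⟩
    ≈ B n
    -ₚ (∑[ k ∈ 1 ⋯ n ∸ 2 ] ((3x *ₚ B (n ∸ k) -ₚ # 2 *ₚ B (n ∸ k ∸ 1)) *ₚ F k ⟨ 3x ⟩)))
    × (# 9 *ₚ x ^ₚ 2 *ₚ F (2 * n) ⟨ 3x ⟩
    ≈ C (2 * n + 1) -ₚ C (2 * n ∸ 1)
    -ₚ (# 27 *ₚ x ^ₚ 2 -ₚ # 4)
    *ₚ (∑[ k ∈ 0 ⋯ n ∸ 1 ] (C (2 * (n ∸ k) ∸ 1) *ₚ F (2 * k + 1) ⟨ 3x ⟩)))
    × (# 6 *ₚ x *ₚ F (2 * n + 1) ⟨ 3x ⟩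
    ≈ B (2 * (n + 1)) -ₚ B (2 * n)
    -ₚ (# 27 *ₚ x ^ₚ 2 -ₚ # 4)
    *ₚ (∑[ k ∈ 0 ⋯ n ∸ 1 ] (B (2 * (n ∸ k)) *ₚ F (2 * k + 1) ⟨ 3x ⟩)))
    × (F (2 * n) ⟨ 3x ⟩ +ₚ F (2 * n ∸ 2) ⟨ 3x ⟩
    ≈ 3x *ₚ B (2 * n ∸ 1)
    -ₚ (# 27 *ₚ x ^ₚ 2 -ₚ # 4)
    *ₚ (∑[ k ∈ 1 ⋯ n ∸ 1 ] (B (2 * (n ∸ k) ∸ 1) *ₚ F (2 * k) ⟨ 3x ⟩)))
    × (# 9 *ₚ x ^ₚ 2 *ₚ F (2 * n ∸ 1) ⟨ 3x ⟩
    ≈ 3x *ₚ C (2 * n ∸ 1)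
    -ₚ (# 27 *ₚ x ^ₚ 2 -ₚ # 4)
    *ₚ (∑[ k ∈ 1 ⋯ n ∸ 1 ] (C (2 * (n ∸ k) ∸ 1) *ₚ F (2 * k) ⟨ 3x ⟩)))
    × (# 6 *ₚ x *ₚ F (2 * n) ⟨ 3x ⟩
    ≈ 3x *ₚ B (2 * n)
    -ₚ (# 27 *ₚ x ^ₚ 2 -ₚ # 4)
    *ₚ (∑[ k ∈ 1 ⋯ n ∸ 1 ] (B (2 * (n ∸ k)) *ₚ F (2 * k) ⟨ 3x ⟩)))
corollary4 (suc n) _ =
    -- For a successor index `suc n ∸ 1` computes, and each `∑` has the length of its `sum`. The
    -- first two sums end one term earlier, which calls for a further case split.
    part₁ n , part₂ n
  , F-even-via-C n , F-odd-via-B n , F-even-via-B-odd n , F-odd-via-C n , F-even-via-B n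
  where
  part₁ : ∀ n → F (1 + n) ⟨ 3x ⟩ ≈ C n
    -ₚ (∑[ k ∈ 1 ⋯ n ∸ 1 ] ((3x *ₚ C (suc n ∸ k ∸ 1) -ₚ # 2 *ₚ C (suc n ∸ k ∸ 2)) *ₚ F k ⟨ 3x ⟩))
  part₁ zero    = ⟨⟩-const 3x 1ℤ
  part₁ (suc n) = F-via-C n

  part₂ : ∀ n → F (1 + n) ⟨ 3x ⟩ +ₚ 3x *ₚ F n ⟨ 3x ⟩ ≈ B (1 + n)
    -ₚ (∑[ k ∈ 1 ⋯ n ∸ 1 ] ((3x *ₚ B (suc n ∸ k) -ₚ # 2 *ₚ B (suc n ∸ k ∸ 1)) *ₚ F k ⟨ 3x ⟩))
  -- Both sides are the constant 1, but the list on the left has length two with a trailing zero, so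
  -- the coefficients 0 and 1 are separated from the rest.
  part₂ zero    = λ where
    zero          → ≡.refl
    (suc zero)    → ≡.refl
    (suc (suc i)) → ≡.refl
  part₂ (suc n) = F-via-B n
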